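{- (Knowledge leakage) ADPAL does not verify the $\to$ direction of (KP'): there exist an ADPAL model $M$ (over some sets of agents and atoms), a state $s$ of $M$, an agent $a$, and formulas $\varphi,\psi\in\mathcal{L}^\infty$ such that $(M,s)\models\mathcal{F}_\varphi(K_a\psi)$ and $(M,s)\models[\varphi]K_a\psi$, but $(M,s)\not\models\varphi\to K_a\psi$.
   Context: For a set $\mathcal{A}$ of agents and a set $\mathcal{P}$ of propositional atoms, the language $\mathcal{L}^\infty$ is generated by $\varphi ::= p \mid E_a^d \mid P_a^d \mid \neg\varphi \mid \varphi\wedge\varphi \mid K_a\varphi \mid K_a^\infty\varphi \mid [\varphi]\varphi$ with $p\in\mathcal{P}$, $a\in\mathcal{A}$, $d\in\mathbb{N}=\{0,1,\dots\}$. Other connectives are the usual abbreviations. Modal depth: $d(p)=d(E_a^d)=d(P_a^d)=0$, $d(\neg\varphi)=d(\varphi)$, $d(\varphi\wedge\psi)=\max(d(\varphi),d(\psi))$, $d(K_a\varphi)=d(K_a^\infty\varphi)=1+d(\varphi)$, $d([\varphi]\psi)=d(\varphi)+d(\psi)$. An ADPAL model is a tuple $M=(\mathcal{S},\sim,V,d)$ with $\mathcal{S}$ a set of states, $\sim_a$ a reflexive relation on $\mathcal{S}$ for each agent $a$ (only reflexivity is assumed), $V:\mathcal{S}\to 2^{\mathcal{P}}$, and $d:\mathcal{A}\times\mathcal{S}\to\mathbb{N}$. Semantics: $(M,s)\models p$ iff $p\in V(s)$; $(M,s)\models E_a^d$ iff $d(a,s)=d$; $(M,s)\models P_a^d$ iff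 $d(a,s)\ge d$; $\neg,\wedge$ as usual; $(M,s)\models K_a^\infty\varphi$ iff $(M,s')\models\varphi$ for all $s'$ with $s\sim_a s'$; $(M,s)\models K_a\varphi$ iff $(M,s)\models P_a^{d(\varphi)}\wedge K_a^\infty\varphi$; $(M,s)\models[\varphi]\psi$ iff ($(M,s)\models\varphi$ implies $(M\mid\varphi,s)\models\psi$), where $M\mid\varphi=(\mathcal{S},\sim',V,d')$ and: $s\not\sim'_a s'$ iff $s\not\sim_a s'$ or [ $(M,s)\models P_a^{d(\varphi)}$ and ( $(M,s)\models\varphi$ iff $(M,s')\not\models\varphi$ ) ]; $d'(a,s)=d(a,s)$ if $d(a,s)<d(\varphi)$ and $d'(a,s)=d(a,s)-d(\varphi)$ otherwise. For $\varphi\in\mathcal{L}^\infty$, the map $\mathcal{F}_\varphi:\mathcal{L}^\infty\to\mathcal{L}^\infty$ is defined inductively, for all agents $b$, by $\mathcal{F}_\varphi(p)=\mathcal{F}_\varphi(E_b^d)=\mathcal{F}_\varphi(P_b^d)=\top$; $\mathcal{F}_\varphi(\neg\psi)=\mathcal{F}_\varphi(\psi)$; $\mathcal{F}_\varphi(\psi\wedge\chi)=\mathcal{F}_\varphi(\psi)\wedge\mathcal{F}_\varphi(\chi)$; $\mathcal{F}_\varphi(K_b\psi)=\neg K_b^\infty(\varphi\to P_b^{d(\varphi)})\wedge K_b^\infty(\varphi\to(\neg P_b^{d(\varphi)}\vee P_b^{d(\varphi)+d(\psi)}))\wedge K_b^\infty\mathcal{F}_\varphi(\psi)$; $\mathcal{F}_\varphi(K_b^\infty\psi)=\neg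 K_b^\infty(\varphi\to P_b^{d(\varphi)})\wedge K_b^\infty\mathcal{F}_\varphi(\psi)$; $\mathcal{F}_\varphi([\psi_1]\psi_2)=\mathcal{F}_\varphi(\psi_1)\wedge\mathcal{F}_\varphi(\psi_2)$. (KP') is the scheme $\mathcal{F}_\varphi(K_a\psi)\to\big([\varphi]K_a\psi\leftrightarrow(\varphi\to K_a\psi)\big)$. -}

module Defs where

open import Data.Bool using (if_then_else_)
open import Data.Nat using (ℕ; _+_; _∸_; _⊔_; _≥_; _<ᵇ_)
open import Data.Product using (_×_; _,_)
open import Function.Bundles using (_⇔_; module Equivalence)
open import Level using (0ℓ)
open import Relation.Binary using (Reflexive)
open import Relation.Binary.PropositionalEquality using (_≡_)
open import Relation.Nullary using (¬_)
open import Relation.Unary using (Pred)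

module Language (Agent Atom : Set) where

  infix  30 ~_
  infixr 25 _∧_
  infixr 24 _∨_
  infixr 23 _⇒_
  infixr 28 [_]_

  data Formula : Set where
    atom : Atom → Formula
    E    : Agent → ℕ → Formula
    P    : Agent → ℕ → Formula
    ~_   : Formula → Formula
    _∧_  : Formula → Formula → Formula
    K    : Agent → Formula → Formula
    K∞   : Agent → Formula → Formula
    [_]_ : Formula → Formula → Formula

  _∨_ : Formula → Formula → Formula
  φ ∨ ψ = ~ (~ φ ∧ ~ ψ)

  _⇒_ : Formula → Formula → Formula
  φ ⇒ ψ = ~ (φ ∧ ~ ψ)

  -- The grammar has no constant for truth, and no closed formula when there
  -- are neither agents nor atoms, so ⊤ is the tautology θ ∨ ¬ θ for a given θ.
  ⊤[_] : Formula → Formula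
  ⊤[ θ ] = θ ∨ ~ θ

  depth : Formula → ℕ
  depth (atom p)  = 0
  depth (E a n)   = 0
  depth (P a n)   = 0
  depth (~ φ)     = depth φ
  depth (φ ∧ ψ)   = depth φ ⊔ depth ψ
  depth (K a φ)   = 1 + depth φ
  depth (K∞ a φ)  = 1 + depth φ
  depth ([ φ ] ψ) = depth φ + depth ψ

  record Model : Set₁ where
    field
      State  : Set
      _∼⟨_⟩_ : State → Agent → State → Set
      ∼-refl : ∀ a → Reflexive (λ s t → s ∼⟨ a ⟩ t)
      V      : State → Pred Atom 0ℓ
      d      : Agent → State → ℕ

  open Model

  infix 4 _,_⊨_
  infixl 5 _∣_

  _,_⊨_ : (M : Model) → State M → Formula → Set
  _∣_   : Model → Formula → Model

  -- The surviving relation is the complement of the usual definition of the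
  -- severed links: s and t are disconnected iff they already were, or
  -- P_a^{d(φ)} holds at s and (φ holds at s iff φ fails at t).
  State  (M ∣ φ) = State M
  _∼⟨_⟩_ (M ∣ φ) s a t =
    (_∼⟨_⟩_ M s a t) ×
    ¬ ((d M a s ≥ depth φ) × ((M , s ⊨ φ) ⇔ (¬ (M , t ⊨ φ))))
  ∼-refl (M ∣ φ) a {s} = ∼-refl M a , λ (_ , e) →
    let open Equivalence e
        ¬φ = λ x → to x x
    in ¬φ (from ¬φ)
  V      (M ∣ φ) = V M
  d      (M ∣ φ) a s =
    if d M a s <ᵇ depth φ then d M a s else d M a s ∸ depth φ

  M , s ⊨ atom p  = V M s p
  M , s ⊨ E a n   = d M a s ≡ n
  M , s ⊨ P a n   = d M a s ≥ n
  M , s ⊨ ~ φ     = ¬ (M , s ⊨ φ)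
  M , s ⊨ φ ∧ ψ   = (M , s ⊨ φ) × (M , s ⊨ ψ)
  M , s ⊨ K a φ   =
    (d M a s ≥ depth φ) × (∀ t → _∼⟨_⟩_ M s a t → M , t ⊨ φ)
  M , s ⊨ K∞ a φ  = ∀ t → _∼⟨_⟩_ M s a t → M , t ⊨ φ
  M , s ⊨ [ φ ] ψ = M , s ⊨ φ → (M ∣ φ) , s ⊨ ψ

  𝓕 : Formula → Formula → Formula
  𝓕 φ (atom p)  = ⊤[ atom p ]
  𝓕 φ (E b n)   = ⊤[ E b n ]
  𝓕 φ (P b n)   = ⊤[ P b n ]
  𝓕 φ (~ ψ)     = 𝓕 φ ψ
  𝓕 φ (ψ ∧ χ)   = 𝓕 φ ψ ∧ 𝓕 φ χ
  𝓕 φ (K b ψ)   =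
      ~ K∞ b (φ ⇒ P b (depth φ))
    ∧ K∞ b (φ ⇒ (~ P b (depth φ) ∨ P b (depth φ + depth ψ)))
    ∧ K∞ b (𝓕 φ ψ)
  𝓕 φ (K∞ b ψ)  =
      ~ K∞ b (φ ⇒ P b (depth φ))
    ∧ K∞ b (𝓕 φ ψ)
  𝓕 φ ([ ψ ] χ) = 𝓕 φ ψ ∧ 𝓕 φ χ

{-# OPTIONS --safe #-}
-- An announcement consumes the depth of every agent deep enough to process it.
-- So b's depth drops from 1 to 0 when a formula φ of depth 1 is announced, and
-- agent a comes to know E_b^0 although a is too shallow to process φ itself.
-- A single state suffices.
module Submission where

open import Data.Empty using (⊥)
open import Data.Nat using (ℕ; z≤n)
open import Data.Product using (Σ-syntax; _×_; _,_)
open import Data.Unit using (⊤; tt)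
open import Relation.Binary.PropositionalEquality using (refl)
open import Relation.Nullary using (¬_)
open import Defs

data Agent₂ : Set where
  a b : Agent₂

module Leakage where

  open Language Agent₂ ⊥

  initialDepth : Agent₂ → ℕ
  initialDepth a = 0
  initialDepth b = 1

  onePoint : Model
  onePoint = record
    { State  = ⊤
    ; _∼⟨_⟩_ = λ _ _ _ → ⊤
    ; ∼-refl = λ _ → tt
    ; V      = λ _ ()
    ; d      = λ c _ → initialDepth c
    }

  -- A validity, chosen for its depth 1: above the depth 0 of `a`, and exactly the depth of `b`, so
  -- that announcing it brings `b` to 0.
  announced : Formula
  announced = K∞ a (P a 0)

  announced-true : onePoint , tt ⊨ announced
  announced-true _ _ = z≤n

  E-false : ¬ (onePoint , tt ⊨ E b 0)
  E-false ()

open Leakage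

proposition3p4 : Σ[ Agent ∈ Set ] Σ[ Atom ∈ Set ]
    (let open Language Agent Atom in
    Σ[ M ∈ Model ] Σ[ s ∈ Model.State M ] Σ[ a ∈ Agent ]
    Σ[ φ ∈ Formula ] Σ[ ψ ∈ Formula ]
    (M , s ⊨ 𝓕 φ (K a ψ)) ×
    (M , s ⊨ [ φ ] (K a ψ)) ×
    (¬ (M , s ⊨ φ ⇒ K a ψ)))
proposition3p4 =
  Agent₂ , ⊥ , onePoint , tt , a , announced , Language.E b 0 ,
  -- The first two conjuncts both hold because `P a 1` fails at the only state.
  ( (λ all-deep → all-deep tt tt (announced-true , λ ()))
  , (λ _ _ (_ , ¬disj) → ¬disj (λ (¬¬deep , _) → ¬¬deep (λ ())))
  , (λ _ _ (¬E , ¬¬E) → ¬¬E ¬E)) ,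
  -- As 1 is not below 1, the depth of `b` becomes 1 ∸ 1, which computes to 0; `E b 0` has depth 0,
  -- within reach of `a`.
  (λ _ → z≤n , λ _ _ → refl) ,
  (λ imp → imp (announced-true , λ (_ , knows) → E-false (knows tt tt)))
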